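{- Let $p\ge q\ge 1$ be integers. Let $Q_{p,q}\subseteq\mathbb{R}^{\mathcal{I}_{p,q}}$ be the polytope defined by the nonnegativity constraints $x\ge 0$, the row-sum inequalities $x(\mathrm{row}_i)\le 1$ for all $i\in[p]$, and all shifted-column inequalities. Let $$P_{p,q}=\{(x,y)\in\mathbb{R}^{\mathcal{I}_{p,q}}\times\mathbb{R}^{A_{p,q}} : y\in F_{p,q},\ (x,y)\text{ satisfies (a) and (b)}\},$$ where (a) is $y_{(i-1,j-1)^{\searrow}}\le x_{ij}$ for all $(i,j)\in\mathcal{I}_{p,q}$, and (b) is $x(\mathrm{bar}_{i,j})\le y(\mathrm{in}^{\searrow}(\mathrm{col}_{i,j}))$ for all $(i,j)\in\mathcal{I}_{p,q}$. Then for each $x\in Q_{p,q}$ there is some $y\in F_{p,q}$ with $(x,y)\in P_{p,q}$.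
   Context: Notation: $[n]=\{1,\dots,n\}$, $[n]_0=\{0,1,\dots,n\}$, $q(i)=\min\{i,q\}$, $\mathcal{I}_{p,q}=\{(i,j)\in[p]\times[q] : i\ge j\}$, $\mathrm{row}_i=\{(i,j)\in\mathcal{I}_{p,q} : j\in[q]\}$. For a vector $z\in\mathbb{R}^M$ and $N\subseteq M$, $z(N)=\sum_{e\in N}z_e$. The directed acyclic graph $D_{p,q}=(V_{p,q},A_{p,q})$ has node set $V_{p,q}=\mathcal{I}_{p,q}\uplus([p]_0\times\{0\})\uplus\{s\}\uplus\{t\}$ and the following arcs: - vertical arcs $(i,j)^{\downarrow}=((i,j),(i+1,j))$ for $i\in[p-1]_0$, $j\in[q(i)]_0$; - diagonal arcs $(i,j)^{\searrow}=((i,j),(i+1,j+1))$ for $i\in[p-1]_0$, $j\in[q(i+1)-1]_0$; - the arc $(s,(0,0))$; - the arcs $((p,j),t)$ for $j\in[q]_0$. $F_{p,q}\subseteq\mathbb{R}^{A_{p,q}}$ is the set of all $s$-$t$-flows in $D_{p,q}$ of flow value one without capacity restrictions: $y\ge 0$, flow conservation at every node other than $s,t$, and one unit of flow leaving $s$. For $W\subseteq V_{p,q}$, $\mathrm{in}^{\searrow}(W)$ is the set of diagonal arcs $(u,w)$ with $w\in W$, $u\notin W$. For $(i,j)\in\mathcal{I}_{p,q}$: $\mathrm{bar}_{i,j}=\{(i,\ell)\in\mathcal{I}_{p,q} : \ell\ge j\}$ and $\mathrm{col}_{i,j}=\{(k,j) : j\le k\le i\}$. Shifted-column inequalities: for a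 directed path $\Gamma$ in $D_{p,q}$ (possibly of length zero), $S(\Gamma)$ is the set of nodes on $\Gamma$ that are not entered by $\Gamma$ via diagonal arcs (so the start node of $\Gamma$ always belongs to $S(\Gamma)$). A subset $S\subseteq\mathcal{I}_{p,q}$ is a shifted column if $S=S(\Gamma)$ for some directed path $\Gamma$ in $D_{p,q}$ from $(\ell,\ell)$ to $(i-1,j-1)$ with $i\in[p]\setminus\{1\}$, $j\in[q]\setminus\{1\}$, $\ell\in[q]$. The associated shifted-column inequality is $x(\mathrm{bar}_{i,j})\le x(S)$. -}

module Defs where

open import Data.Empty using (⊥)
open import Data.Fin.Base using (toℕ)
open import Data.Fin.Properties using (toℕ<n)
open import Data.List.Base using (List; []; _∷_; _++_; concat; filter; foldr; map; tabulate)
import Data.List.Membership.DecPropositional as DecMembership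
open import Data.Nat using (ℕ; suc; pred; _≤_; _<_; _⊓_; _⊔_; _≟_; _≤?_; s≤s; s≤s⁻¹; z≤n)
open import Data.Nat.Properties
  using (≤-refl; ≤-trans; m≤n⊓o⇒m≤n; m≤n⊓o⇒m≤o; ⊓-glb; m⊔n≤o⇒m≤o; m⊔n≤o⇒n≤o; n≤1+n)
open import Data.Product.Base using (∃; _×_; _,_)
import Data.Rational as ℚ
open ℚ using (ℚ; 0ℚ; 1ℚ; ½)
import Data.Rational.Properties as ℚₚ
open import Data.Unit.Base using (⊤; tt)
open import Level using (0ℓ)
open import Relation.Binary.Definitions using (DecidableEquality)
open import Relation.Binary.PropositionalEquality
  using (_≡_; _≢_; refl; sym; trans; cong; cong₂; subst)
open import Relation.Nullary using (¬_; yes; no)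
open import Relation.Nullary.Decidable using (_×-dec_; ¬?)
open import Relation.Unary using (Pred; Decidable)

-- Real numbers: Cauchy sequences of rationals, with equality and order
-- "up to a null sequence".

record ℝ : Set where
  constructor mkℝ
  field
    seq    : ℕ → ℚ
    cauchy : ∀ ε → 0ℚ ℚ.< ε →
             ∃ λ N → ∀ m n → N ≤ m → N ≤ n → ℚ.∣ seq m ℚ.- seq n ∣ ℚ.≤ ε

open ℝ public

infix 4 _≈ℝ_ _≤ℝ_
infixl 6 _+ℝ_

_≈ℝ_ : ℝ → ℝ → Set
x ≈ℝ y = ∀ ε → 0ℚ ℚ.< ε → ∃ λ N → ∀ n → N ≤ n → ℚ.∣ seq x n ℚ.- seq y n ∣ ℚ.≤ ε

_≤ℝ_ : ℝ → ℝ → Set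
x ≤ℝ y = ∀ ε → 0ℚ ℚ.< ε → ∃ λ N → ∀ n → N ≤ n → seq x n ℚ.≤ seq y n ℚ.+ ε

fromℚ : ℚ → ℝ
fromℚ r .seq _ = r
fromℚ r .cauchy ε ε>0 = 0 , λ _ _ _ _ →
  subst (λ d → ℚ.∣ d ∣ ℚ.≤ ε) (sym (ℚₚ.+-inverseʳ r)) (ℚₚ.<⇒≤ ε>0)

0ℝ 1ℝ : ℝ
0ℝ = fromℚ 0ℚ
1ℝ = fromℚ 1ℚ

private
  half>0 : ∀ {ε} → 0ℚ ℚ.< ε → 0ℚ ℚ.< ½ ℚ.* ε
  half>0 {ε} ε>0 = subst (ℚ._< ½ ℚ.* ε) (ℚₚ.*-zeroʳ ½) (ℚₚ.*-monoʳ-<-pos ½ ε>0)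

  half+half : ∀ ε → ½ ℚ.* ε ℚ.+ ½ ℚ.* ε ≡ ε
  half+half ε = trans (sym (ℚₚ.*-distribʳ-+ ε ½ ½)) (ℚₚ.*-identityˡ ε)

  interchange : ∀ a b c d → (a ℚ.+ b) ℚ.- (c ℚ.+ d) ≡ (a ℚ.- c) ℚ.+ (b ℚ.- d)
  interchange a b c d = trans (cong ((a ℚ.+ b) ℚ.+_) (ℚₚ.neg-distrib-+ c d))
    (trans (ℚₚ.+-assoc a b _)
    (trans (cong (a ℚ.+_)
      (trans (sym (ℚₚ.+-assoc b (ℚ.- c) (ℚ.- d)))
      (trans (cong (ℚ._+ (ℚ.- d)) (ℚₚ.+-comm b (ℚ.- c)))
             (ℚₚ.+-assoc (ℚ.- c) b (ℚ.- d)))))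
      (sym (ℚₚ.+-assoc a (ℚ.- c) _))))

_+ℝ_ : ℝ → ℝ → ℝ
(x +ℝ y) .seq n = seq x n ℚ.+ seq y n
(x +ℝ y) .cauchy ε ε>0
  with N , hx ← cauchy x (½ ℚ.* ε) (half>0 ε>0)
     | M , hy ← cauchy y (½ ℚ.* ε) (half>0 ε>0)
  = N ⊔ M , λ m n N⊔M≤m N⊔M≤n → begin
      ℚ.∣ (seq x m ℚ.+ seq y m) ℚ.- (seq x n ℚ.+ seq y n) ∣
        ≡⟨ cong ℚ.∣_∣ (interchange (seq x m) (seq y m) (seq x n) (seq y n)) ⟩
      ℚ.∣ (seq x m ℚ.- seq x n) ℚ.+ (seq y m ℚ.- seq y n) ∣
        ≤⟨ ℚₚ.∣p+q∣≤∣p∣+∣q∣ (seq x m ℚ.- seq x n) (seq y m ℚ.- seq y n) ⟩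
      ℚ.∣ seq x m ℚ.- seq x n ∣ ℚ.+ ℚ.∣ seq y m ℚ.- seq y n ∣
        ≤⟨ ℚₚ.+-mono-≤ (hx m n (m⊔n≤o⇒m≤o N M N⊔M≤m) (m⊔n≤o⇒m≤o N M N⊔M≤n))
                       (hy m n (m⊔n≤o⇒n≤o N M N⊔M≤m) (m⊔n≤o⇒n≤o N M N⊔M≤n)) ⟩
      ½ ℚ.* ε ℚ.+ ½ ℚ.* ε
        ≡⟨ half+half ε ⟩
      ε ∎
  where open ℚₚ.≤-Reasoning

-- z(N), where M lists every element of the finite index set exactly once.
total : {A : Set} {N : Pred A 0ℓ} → List A → (A → ℝ) → Decidable N → ℝ
total M z N? = foldr _+ℝ_ 0ℝ (map z (filter N? M))

module Orbitope (p q : ℕ) .(q≤p : q ≤ p) where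

  q⟨_⟩ : ℕ → ℕ
  q⟨ i ⟩ = i ⊓ q

  -- The index set 𝓘_{p,q}.  Range conditions are irrelevant, here and below,
  -- so that indices with the same coordinates are definitionally equal.
  record Cell : Set where
    constructor cell
    field
      row col : ℕ
      .1≤row   : 1 ≤ row
      .row≤p   : row ≤ p
      .1≤col   : 1 ≤ col
      .col≤q   : col ≤ q
      .col≤row : col ≤ row

  open Cell public using (row; col)

  cells : List Cell
  cells = concat (tabulate {n = p} λ i →
                  tabulate {n = q⟨ suc (toℕ i) ⟩} λ j →
    cell (suc (toℕ i)) (suc (toℕ j))
         (s≤s z≤n) (toℕ<n i) (s≤s z≤n)
         (m≤n⊓o⇒m≤o (suc (toℕ i)) q (toℕ<n j))
         (m≤n⊓o⇒m≤n (suc (toℕ i)) q (toℕ<n j)))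

  -- `pt i j` covers both 𝓘_{p,q} (j ≥ 1) and [p]₀ × {0} (j = 0).
  data Node : Set where
    pt  : (i j : ℕ) → .(i ≤ p) → .(j ≤ q⟨ i ⟩) → Node
    s t : Node

  node : Cell → Node
  node (cell i j _ i≤p _ j≤q j≤i) = pt i j i≤p (⊓-glb j≤i j≤q)

  infix 4 _≟ᴺ_
  _≟ᴺ_ : DecidableEquality Node
  pt i j _ _ ≟ᴺ pt k l _ _ with i ≟ k | j ≟ l
  ... | yes refl | yes refl = yes refl
  ... | no i≢k   | _        = no λ { refl → i≢k refl }
  ... | yes _    | no j≢l   = no λ { refl → j≢l refl }
  pt _ _ _ _ ≟ᴺ s = no λ ()
  pt _ _ _ _ ≟ᴺ t = no λ ()
  s ≟ᴺ pt _ _ _ _ = no λ ()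
  s ≟ᴺ s = yes refl
  s ≟ᴺ t = no λ ()
  t ≟ᴺ pt _ _ _ _ = no λ ()
  t ≟ᴺ s = no λ ()
  t ≟ᴺ t = yes refl

  data Arc : Set where
    vert : (i j : ℕ) → .(i < p) → .(j ≤ q⟨ i ⟩) → Arc
    diag : (i j : ℕ) → .(i < p) → .(j < q⟨ suc i ⟩) → Arc
    source : Arc
    sink : (j : ℕ) → .(j ≤ q) → Arc

  private
    pred< : ∀ {m n} → 1 ≤ m → m ≤ n → pred m < n
    pred< (s≤s _) m≤n = m≤n

    vert-bound : ∀ i j → j ≤ q⟨ i ⟩ → j ≤ q⟨ suc i ⟩
    vert-bound i j h =
      ⊓-glb (≤-trans (m≤n⊓o⇒m≤n i q h) (n≤1+n i)) (m≤n⊓o⇒m≤o i q h)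

    diag-bound : ∀ i j → j < q⟨ suc i ⟩ → j ≤ q⟨ i ⟩
    diag-bound i j h =
      ⊓-glb (s≤s⁻¹ (m≤n⊓o⇒m≤n (suc i) q h))
            (≤-trans (n≤1+n j) (m≤n⊓o⇒m≤o (suc i) q h))

    pred-bound : ∀ {i j} → 1 ≤ i → 1 ≤ j → j ≤ q → j ≤ i → pred j < q⟨ suc (pred i) ⟩
    pred-bound (s≤s _) (s≤s _) j≤q j≤i = ⊓-glb j≤i j≤q

  tail head : Arc → Node
  tail (vert i j i<p h) = pt i j (≤-trans (n≤1+n i) i<p) h
  tail (diag i j i<p h) = pt i j (≤-trans (n≤1+n i) i<p) (diag-bound i j h)
  tail source           = s
  tail (sink j j≤q)     = pt p j ≤-refl (⊓-glb (≤-trans j≤q q≤p) j≤q)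
  head (vert i j i<p h) = pt (suc i) j i<p (vert-bound i j h)
  head (diag i j i<p h) = pt (suc i) (suc j) i<p h
  head source           = pt 0 0 z≤n z≤n
  head (sink _ _)       = t

  arcs : List Arc
  arcs = concat (tabulate {n = p} λ i →
                 tabulate {n = suc q⟨ toℕ i ⟩} λ j →
                   vert (toℕ i) (toℕ j) (toℕ<n i) (s≤s⁻¹ (toℕ<n j)))
      ++ concat (tabulate {n = p} λ i →
                 tabulate {n = q⟨ suc (toℕ i) ⟩} λ j →
                   diag (toℕ i) (toℕ j) (toℕ<n i) (toℕ<n j))
      ++ source
      ∷  tabulate {n = suc q} λ j → sink (toℕ j) (s≤s⁻¹ (toℕ<n j))

  IsDiagonal : Pred Arc 0ℓ
  IsDiagonal (diag _ _ _ _) = ⊤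
  IsDiagonal (vert _ _ _ _) = ⊥
  IsDiagonal source         = ⊥
  IsDiagonal (sink _ _)     = ⊥

  isDiagonal? : Decidable IsDiagonal
  isDiagonal? (diag _ _ _ _) = yes tt
  isDiagonal? (vert _ _ _ _) = no λ ()
  isDiagonal? source         = no λ ()
  isDiagonal? (sink _ _)     = no λ ()

  -- The arc (i-1, j-1)↘ entering the cell (i, j).
  diagInto : Cell → Arc
  diagInto (cell i j 1≤i i≤p 1≤j j≤q j≤i) =
    diag (pred i) (pred j) (pred< 1≤i i≤p) (pred-bound 1≤i 1≤j j≤q j≤i)

  Row : ℕ → Pred Cell 0ℓ
  Row i e = row e ≡ i

  row? : ∀ i → Decidable (Row i)
  row? i e = row e ≟ i

  Bar : Cell → Pred Cell 0ℓ
  Bar c e = row e ≡ row c × col c ≤ col e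

  bar? : ∀ c → Decidable (Bar c)
  bar? c e = row e ≟ row c ×-dec col c ≤? col e

  Col : Cell → Pred Node 0ℓ
  Col c (pt k l _ _) = l ≡ col c × col c ≤ k × k ≤ row c
  Col c s            = ⊥
  Col c t            = ⊥

  col? : ∀ c → Decidable (Col c)
  col? c (pt k l _ _) = l ≟ col c ×-dec col c ≤? k ×-dec k ≤? row c
  col? c s            = no λ ()
  col? c t            = no λ ()

  In↘ : Pred Node 0ℓ → Pred Arc 0ℓ
  In↘ W a = IsDiagonal a × W (head a) × ¬ W (tail a)

  in↘? : ∀ {W} → Decidable W → Decidable (In↘ W)
  in↘? W? a = isDiagonal? a ×-dec W? (head a) ×-dec ¬? (W? (tail a))

  infixr 5 _◅_
  data Path : Node → Node → Set where
    stop : ∀ {u} → Path u u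
    _◅_  : ∀ {v} (a : Arc) → Path (head a) v → Path (tail a) v

  -- The graph is acyclic, so a node on Γ is entered by Γ at most once.
  enteredNonDiagonally : ∀ {u v} → Path u v → List Node
  enteredNonDiagonally stop = []
  enteredNonDiagonally (a ◅ Γ) with isDiagonal? a
  ... | yes _ = enteredNonDiagonally Γ
  ... | no  _ = head a ∷ enteredNonDiagonally Γ

  S : ∀ {u v} → Path u v → List Node
  S {u} Γ = u ∷ enteredNonDiagonally Γ

  open DecMembership _≟ᴺ_ using (_∈_; _∈?_)

  -- S(Γ) as a subset of 𝓘_{p,q}; for the paths used below every node of S(Γ)
  -- is of the form `node e`.
  InS : ∀ {u v} → Path u v → Pred Cell 0ℓ
  InS Γ e = node e ∈ S Γ

  inS? : ∀ {u v} (Γ : Path u v) → Decidable (InS Γ)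
  inS? Γ e = node e ∈? S Γ

  diagonalNode : (l : ℕ) → .(l ≤ q) → Node
  diagonalNode l l≤q = pt l l (≤-trans l≤q q≤p) (⊓-glb ≤-refl l≤q)

  -- The node (i-1, j-1).  It lies in the graph only if i ≥ j, so a
  -- shifted-column inequality always belongs to a cell (i, j).
  northwest : Cell → Node
  northwest c = tail (diagInto c)

  record _∈Q (x : Cell → ℝ) : Set where
    field
      nonneg        : ∀ e → 0ℝ ≤ℝ x e
      rowSum        : ∀ i → 1 ≤ i → i ≤ p → total cells x (row? i) ≤ℝ 1ℝ
      shiftedColumn : ∀ c → row c ≢ 1 → col c ≢ 1 →
                      ∀ l → 1 ≤ l → (l≤q : l ≤ q) →
                      (Γ : Path (diagonalNode l l≤q) (northwest c)) →
                      total cells x (bar? c) ≤ℝ total cells x (inS? Γ)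

  record _∈F (y : Arc → ℝ) : Set where
    field
      nonneg       : ∀ a → 0ℝ ≤ℝ y a
      conservation : ∀ v → v ≢ s → v ≢ t →
                     total arcs y (λ a → head a ≟ᴺ v) ≈ℝ total arcs y (λ a → tail a ≟ᴺ v)
      value        : total arcs y (λ a → tail a ≟ᴺ s) ≈ℝ 1ℝ

  record ⟨_,_⟩∈P (x : Cell → ℝ) (y : Arc → ℝ) : Set where
    field
      flow   : y ∈F
      diag≤x : ∀ c → y (diagInto c) ≤ℝ x c
      bar≤in : ∀ c → total cells x (bar? c) ≤ℝ total arcs y (in↘? (col? c))

{-# OPTIONS --safe #-}

-- A flow is described by F i j, the amount that enters column j on diagonal arcs down to
-- row i (with F i 0 = 1): the diagonal arc into (i, j) carries F i j - F (i-1) j and the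
-- vertical arc leaving (i, j) carries F i j - F (i+1) (j+1).  The greedy choice
--   F i j = min (F (i-1) j + x_ij) (F (i-1) (j-1))
-- satisfies (a) and gives y ≥ 0.  Unfolded, it is the minimum of x(S(Γ)) over the
-- paths Γ from some (ℓ, ℓ) to (i, j) and of the costs of the paths from column 0, which
-- are at least 1.  So the shifted-column and row-sum inequalities say that
-- x(bar_ij) ≤ F (i-1) (j-1), and (b) follows by applying this to j and to j + 1.

module Submission where

open import Data.Empty using (⊥-elim-irr)
open import Data.Fin.Base using (Fin; toℕ; fromℕ<)
open import Data.Fin.Properties using (toℕ<n; toℕ-injective; toℕ-fromℕ<)
open import Data.List.Base using (List; []; _∷_; _++_; concat; filter; foldr; map; tabulate)
import Data.List.Membership.DecPropositional as DecMembership
open import Data.List.Membership.Propositional using (_∈_)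
open import Data.List.Membership.Propositional.Properties
  using (∈-++⁺ˡ; ∈-++⁺ʳ; ∈-++⁻; ∈-concat⁺′; ∈-concat⁻′; ∈-tabulate⁺; ∈-tabulate⁻;
         ∈-filter⁺; ∈-filter⁻)
open import Data.List.Membership.Propositional.Properties.WithK using (unique∧set⇒bag)
open import Data.List.Relation.Binary.BagAndSetEquality using (∼bag⇒↭)
open import Data.List.Relation.Binary.Permutation.Propositional as ↭ using (_↭_)
open import Data.List.Relation.Unary.All using (_∷_; [])
import Data.List.Relation.Unary.All as All
import Data.List.Relation.Unary.All.Properties as Allₚ
open import Data.List.Relation.Unary.AllPairs using (_∷_; [])
import Data.List.Relation.Unary.AllPairs.Properties as AllPairsₚ
open import Data.List.Relation.Unary.Any using (here; there)
open import Data.List.Relation.Unary.Unique.Propositional using (Unique)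
import Data.List.Relation.Unary.Unique.Propositional.Properties as Uniqueₚ
open import Data.Nat using (ℕ; zero; suc; _≤_; _<_; _⊔_; _≤?_; _<?_; s≤s; s≤s⁻¹; z≤n)
open import Data.Nat.Properties
  using (≤-refl; ≤-trans; ≤-antisym; <-irrefl; <⇒≤; ≮⇒≥; ⊓-glb; m≤n⊓o⇒m≤n; m≤n⊓o⇒m≤o; m⊔n≤o⇒m≤o;
         m⊔n≤o⇒n≤o; m≤n⇒m≤1+n; m≤n⇒m<n∨m≡n; suc-injective; 1+n≢n)
open import Data.Product using (∃; ∃₂; _×_; _,_; proj₁; proj₂)
open import Data.Rational as ℚ using (ℚ; 0ℚ; ½)
import Data.Rational.Properties as ℚₚ
import Data.Rational.Solver as ℚ-Solver
open import Data.Sum using (_⊎_; inj₁; inj₂; [_,_]′)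
open import Data.Unit using (tt)
open import Defs
open import Function using (mk⇔)
open import Level using (0ℓ)
open import Relation.Binary.PropositionalEquality
  using (_≡_; _≢_; refl; sym; trans; cong; cong₂; subst)
open import Relation.Nullary using (¬_; Dec; yes; no; contradiction; recompute)
open import Relation.Unary using (Pred; Decidable)

-- Arithmetic, order and minimum of real numbers.

infix 4 _≐_ _⊑_
infixl 6 _-ℝ_
infixl 7 _⊓ℝ_

-- Representatives that agree term by term: on sums of a fixed finite family this
-- is all the equality that is needed, and it rewrites without any ε.
_≐_ : ℝ → ℝ → Set
x ≐ y = ∀ n → seq x n ≡ seq y n

p≤∣p∣ : ∀ p → p ℚ.≤ ℚ.∣ p ∣
p≤∣p∣ p with ℚₚ.≤-total 0ℚ p
... | inj₁ 0≤p = ℚₚ.≤-reflexive (sym (ℚₚ.0≤p⇒∣p∣≡p 0≤p))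
... | inj₂ p≤0 = ℚₚ.≤-trans p≤0 (ℚₚ.0≤∣p∣ p)

∣p-q∣≡∣q-p∣ : ∀ p q → ℚ.∣ p ℚ.- q ∣ ≡ ℚ.∣ q ℚ.- p ∣
∣p-q∣≡∣q-p∣ p q = trans
  (cong ℚ.∣_∣ (solve 2 (λ p q → p :- q := :- (q :- p)) refl p q)) (ℚₚ.∣-p∣≡∣p∣ (q ℚ.- p))
  where open ℚ-Solver.+-*-Solver

∣p-q∣≤r⇒p≤q+r : ∀ p q r → ℚ.∣ p ℚ.- q ∣ ℚ.≤ r → p ℚ.≤ q ℚ.+ r
∣p-q∣≤r⇒p≤q+r p q r h = begin
  p                     ≡⟨ solve 2 (λ p q → p := q :+ (p :- q)) refl p q ⟩
  q ℚ.+ (p ℚ.- q)       ≤⟨ ℚₚ.+-monoʳ-≤ q (p≤∣p∣ (p ℚ.- q)) ⟩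
  q ℚ.+ ℚ.∣ p ℚ.- q ∣   ≤⟨ ℚₚ.+-monoʳ-≤ q h ⟩
  q ℚ.+ r               ∎
  where open ℚₚ.≤-Reasoning
        open ℚ-Solver.+-*-Solver

p≤q+r⇒p-q≤r : ∀ p q r → p ℚ.≤ q ℚ.+ r → p ℚ.- q ℚ.≤ r
p≤q+r⇒p-q≤r p q r h = begin
  p ℚ.- q           ≤⟨ ℚₚ.+-monoˡ-≤ (ℚ.- q) h ⟩
  (q ℚ.+ r) ℚ.- q   ≡⟨ solve 2 (λ q r → (q :+ r) :- q := r) refl q r ⟩
  r                 ∎
  where open ℚₚ.≤-Reasoning
        open ℚ-Solver.+-*-Solver

∣p-q∣≤r : ∀ p q r → p ℚ.≤ q ℚ.+ r → q ℚ.≤ p ℚ.+ r → ℚ.∣ p ℚ.- q ∣ ℚ.≤ r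
∣p-q∣≤r p q r p≤ q≤ with ℚₚ.∣p∣≡p∨∣p∣≡-p (p ℚ.- q)
... | inj₁ eq = subst (ℚ._≤ r) (sym eq) (p≤q+r⇒p-q≤r p q r p≤)
... | inj₂ eq = subst (ℚ._≤ r)
  (sym (trans eq (solve 2 (λ p q → :- (p :- q) := q :- p) refl p q)))
  (p≤q+r⇒p-q≤r q p r q≤)
  where open ℚ-Solver.+-*-Solver

⊓-+-glb : ∀ p q r {s} → s ℚ.≤ p ℚ.+ r → s ℚ.≤ q ℚ.+ r → s ℚ.≤ (p ℚ.⊓ q) ℚ.+ r
⊓-+-glb p q r {s} s≤p s≤q with ℚₚ.⊓-sel p q
... | inj₁ eq = subst (λ m → s ℚ.≤ m ℚ.+ r) (sym eq) s≤p
... | inj₂ eq = subst (λ m → s ℚ.≤ m ℚ.+ r) (sym eq) s≤q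

-- The minimum is 1-Lipschitz for the maximum norm, so `_⊓ℝ_` is Cauchy with the same ε as its
-- arguments.
∣⊓-⊓∣≤r : ∀ p q p′ q′ r → ℚ.∣ p ℚ.- p′ ∣ ℚ.≤ r → ℚ.∣ q ℚ.- q′ ∣ ℚ.≤ r →
          ℚ.∣ (p ℚ.⊓ q) ℚ.- (p′ ℚ.⊓ q′) ∣ ℚ.≤ r
∣⊓-⊓∣≤r p q p′ q′ r hp hq = ∣p-q∣≤r (p ℚ.⊓ q) (p′ ℚ.⊓ q′) r
  (half p q p′ q′ hp hq)
  (half p′ q′ p q (subst (ℚ._≤ r) (∣p-q∣≡∣q-p∣ p p′) hp) (subst (ℚ._≤ r) (∣p-q∣≡∣q-p∣ q q′) hq))
  where
  half : ∀ p q p′ q′ → ℚ.∣ p ℚ.- p′ ∣ ℚ.≤ r → ℚ.∣ q ℚ.- q′ ∣ ℚ.≤ r →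
         p ℚ.⊓ q ℚ.≤ (p′ ℚ.⊓ q′) ℚ.+ r
  half p q p′ q′ hp hq = ⊓-+-glb p′ q′ r
    (ℚₚ.≤-trans (ℚₚ.p⊓q≤p p q) (∣p-q∣≤r⇒p≤q+r p p′ r hp))
    (ℚₚ.≤-trans (ℚₚ.p⊓q≤q p q) (∣p-q∣≤r⇒p≤q+r q q′ r hq))

-ℝ_ : ℝ → ℝ
(-ℝ x) .seq n = ℚ.- seq x n
(-ℝ x) .cauchy ε ε>0 with N , hx ← cauchy x ε ε>0 = N , λ m n N≤m N≤n →
  subst (ℚ._≤ ε)
    (cong ℚ.∣_∣ (solve 2 (λ a b → b :- a := (:- a) :- (:- b)) refl (seq x m) (seq x n)))
    (hx n m N≤n N≤m)
  where open ℚ-Solver.+-*-Solver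

_-ℝ_ : ℝ → ℝ → ℝ
x -ℝ y = x +ℝ (-ℝ y)

-- A wrapper around _≤ℝ_: that relation unfolds to a function type, from which
-- Agda cannot infer the two sides.
record _⊑_ (x y : ℝ) : Set where
  constructor wrap
  field unwrap : x ≤ℝ y

open _⊑_ public

pointwise⇒⊑ : ∀ {x y} → (∀ n → seq x n ℚ.≤ seq y n) → x ⊑ y
pointwise⇒⊑ {x} {y} h .unwrap ε ε>0 = 0 , λ n _ → begin
  seq x n             ≤⟨ h n ⟩
  seq y n             ≡⟨ ℚₚ.+-identityʳ (seq y n) ⟨
  seq y n ℚ.+ 0ℚ      ≤⟨ ℚₚ.+-monoʳ-≤ (seq y n) (ℚₚ.<⇒≤ ε>0) ⟩
  seq y n ℚ.+ ε       ∎
  where open ℚₚ.≤-Reasoning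

≐⇒⊑ : ∀ {x y} → x ≐ y → x ⊑ y
≐⇒⊑ h = pointwise⇒⊑ λ n → ℚₚ.≤-reflexive (h n)

≐⇒≈ℝ : ∀ x y → x ≐ y → x ≈ℝ y
≐⇒≈ℝ x y h ε ε>0 = 0 , λ n _ →
  ∣p-q∣≤r (seq x n) (seq y n) ε (proj₂ (x⊑y ε ε>0) n z≤n) (proj₂ (y⊑x ε ε>0) n z≤n)
  where
  x⊑y : x ≤ℝ y
  x⊑y = unwrap (≐⇒⊑ {x} {y} h)
  y⊑x : y ≤ℝ x
  y⊑x = unwrap (≐⇒⊑ {y} {x} λ n → sym (h n))

⊑-refl : ∀ {x} → x ⊑ x
⊑-refl = ≐⇒⊑ λ _ → refl

0<½*p : ∀ {p} → 0ℚ ℚ.< p → 0ℚ ℚ.< ½ ℚ.* p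
0<½*p {p} 0<p = subst (ℚ._< ½ ℚ.* p) (ℚₚ.*-zeroʳ ½) (ℚₚ.*-monoʳ-<-pos ½ 0<p)

½*p+½*p≡p : ∀ p → ½ ℚ.* p ℚ.+ ½ ℚ.* p ≡ p
½*p+½*p≡p p = trans (sym (ℚₚ.*-distribʳ-+ p ½ ½)) (ℚₚ.*-identityˡ p)

+-mono-⊑ : ∀ {x y u v} → x ⊑ y → u ⊑ v → x +ℝ u ⊑ y +ℝ v
+-mono-⊑ {x} {y} {u} {v} x⊑y u⊑v .unwrap ε ε>0
  with N , hx ← unwrap x⊑y (½ ℚ.* ε) (0<½*p ε>0)
     | M , hu ← unwrap u⊑v (½ ℚ.* ε) (0<½*p ε>0)
  = N ⊔ M , λ n ≤n → begin
    seq x n ℚ.+ seq u n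
      ≤⟨ ℚₚ.+-mono-≤ (hx n (m⊔n≤o⇒m≤o N M ≤n)) (hu n (m⊔n≤o⇒n≤o N M ≤n)) ⟩
    (seq y n ℚ.+ ½ ℚ.* ε) ℚ.+ (seq v n ℚ.+ ½ ℚ.* ε)
      ≡⟨ solve 3 (λ y v e → (y :+ e) :+ (v :+ e) := (y :+ v) :+ (e :+ e)) refl
           (seq y n) (seq v n) (½ ℚ.* ε) ⟩
    (seq y n ℚ.+ seq v n) ℚ.+ (½ ℚ.* ε ℚ.+ ½ ℚ.* ε)
      ≡⟨ cong ((seq y n ℚ.+ seq v n) ℚ.+_) (½*p+½*p≡p ε) ⟩
    (seq y n ℚ.+ seq v n) ℚ.+ ε ∎
  where open ℚₚ.≤-Reasoning
        open ℚ-Solver.+-*-Solver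

+-monoˡ-⊑ : ∀ z {x y} → x ⊑ y → x +ℝ z ⊑ y +ℝ z
+-monoˡ-⊑ z x⊑y = +-mono-⊑ x⊑y (⊑-refl {z})

+-monoʳ-⊑ : ∀ z {x y} → x ⊑ y → z +ℝ x ⊑ z +ℝ y
+-monoʳ-⊑ z x⊑y = +-mono-⊑ (⊑-refl {z}) x⊑y

⊑-trans : ∀ {x y z} → x ⊑ y → y ⊑ z → x ⊑ z
⊑-trans {x} {y} {z} x⊑y y⊑z .unwrap ε ε>0
  with N , hx ← unwrap x⊑y (½ ℚ.* ε) (0<½*p ε>0)
     | M , hy ← unwrap y⊑z (½ ℚ.* ε) (0<½*p ε>0)
  = N ⊔ M , λ n ≤n → begin
    seq x n                               ≤⟨ hx n (m⊔n≤o⇒m≤o N M ≤n) ⟩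
    seq y n ℚ.+ ½ ℚ.* ε
      ≤⟨ ℚₚ.+-monoˡ-≤ (½ ℚ.* ε) (hy n (m⊔n≤o⇒n≤o N M ≤n)) ⟩
    (seq z n ℚ.+ ½ ℚ.* ε) ℚ.+ ½ ℚ.* ε     ≡⟨ ℚₚ.+-assoc (seq z n) _ _ ⟩
    seq z n ℚ.+ (½ ℚ.* ε ℚ.+ ½ ℚ.* ε)     ≡⟨ cong (seq z n ℚ.+_) (½*p+½*p≡p ε) ⟩
    seq z n ℚ.+ ε                         ∎
  where open ℚₚ.≤-Reasoning

-- Opaque, as F below, because of η for ℝ: two minima that differ only in irrelevant
-- arguments would be compared by unfolding their Cauchy moduli.
opaque

  _⊓ℝ_ : ℝ → ℝ → ℝ
  (x ⊓ℝ y) .seq n = seq x n ℚ.⊓ seq y n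
  (x ⊓ℝ y) .cauchy ε ε>0
    with N , hx ← cauchy x ε ε>0
       | M , hy ← cauchy y ε ε>0
    = N ⊔ M , λ m n ≤m ≤n → ∣⊓-⊓∣≤r (seq x m) (seq y m) (seq x n) (seq y n) ε
        (hx m n (m⊔n≤o⇒m≤o N M ≤m) (m⊔n≤o⇒m≤o N M ≤n))
        (hy m n (m⊔n≤o⇒n≤o N M ≤m) (m⊔n≤o⇒n≤o N M ≤n))

  ⊓ℝ-glb : ∀ {x y z} → z ⊑ x → z ⊑ y → z ⊑ x ⊓ℝ y
  ⊓ℝ-glb {x} {y} z⊑x z⊑y .unwrap ε ε>0 with N , hx ← unwrap z⊑x ε ε>0 | M , hy ← unwrap z⊑y ε ε>0
    = N ⊔ M , λ n ≤n → ⊓-+-glb (seq x n) (seq y n) ε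
        (hx n (m⊔n≤o⇒m≤o N M ≤n)) (hy n (m⊔n≤o⇒n≤o N M ≤n))

  x⊓y⊑x : ∀ x y → x ⊓ℝ y ⊑ x
  x⊓y⊑x x y = pointwise⇒⊑ λ n → ℚₚ.p⊓q≤p (seq x n) (seq y n)

  x⊓y⊑y : ∀ x y → x ⊓ℝ y ⊑ y
  x⊓y⊑y x y = pointwise⇒⊑ λ n → ℚₚ.p⊓q≤q (seq x n) (seq y n)

  -- Adding `w` distributes over the minimum.
  ⊓ℝ-+ℝ-glb : ∀ {x y z} w → z ⊑ x +ℝ w → z ⊑ y +ℝ w → z ⊑ (x ⊓ℝ y) +ℝ w
  ⊓ℝ-+ℝ-glb {x} {y} w z⊑x z⊑y = ⊑-trans (⊓ℝ-glb z⊑x z⊑y)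
    (≐⇒⊑ λ n → sym (ℚₚ.mono-≤-distrib-⊓ {ℚ._+ seq w n}
      (ℚₚ.+-monoˡ-≤ (seq w n)) (seq x n) (seq y n)))

x⊑y⇒0⊑y-x : ∀ {x y} → x ⊑ y → 0ℝ ⊑ y -ℝ x
x⊑y⇒0⊑y-x {x} x⊑y = ⊑-trans (≐⇒⊑ λ n → sym (ℚₚ.+-inverseʳ (seq x n))) (+-monoˡ-⊑ (-ℝ x) x⊑y)

x⊑y+z⇒x-y⊑z : ∀ {x y z} → x ⊑ y +ℝ z → x -ℝ y ⊑ z
x⊑y+z⇒x-y⊑z {x} {y} {z} h = ⊑-trans (+-monoˡ-⊑ (-ℝ y) h)
  (≐⇒⊑ λ n → solve 2 (λ y z → (y :+ z) :- y := z) refl (seq y n) (seq z n))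
  where open ℚ-Solver.+-*-Solver

y⊑y+x : ∀ {x} y → 0ℝ ⊑ x → y ⊑ y +ℝ x
y⊑y+x y 0⊑x = ⊑-trans (≐⇒⊑ λ n → sym (ℚₚ.+-identityʳ (seq y n))) (+-monoʳ-⊑ y 0⊑x)

y⊑x+y : ∀ {x} y → 0ℝ ⊑ x → y ⊑ x +ℝ y
y⊑x+y y 0⊑x = ⊑-trans (≐⇒⊑ λ n → sym (ℚₚ.+-identityˡ (seq y n))) (+-monoˡ-⊑ y 0⊑x)

-- Sums over finite index sets and their enumerations.

module _ {A : Set} (z : A → ℝ) where

  ∑ : List A → ℝ
  ∑ L = foldr _+ℝ_ 0ℝ (map z L)

  ∑-↭ : ∀ {L L′} → L ↭ L′ → ∑ L ≐ ∑ L′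
  ∑-↭ ↭.refl n = refl
  ∑-↭ (↭.prep a L↭) n = cong (seq (z a) n ℚ.+_) (∑-↭ L↭ n)
  ∑-↭ {L′ = _ ∷ _ ∷ L′} (↭.swap a b L↭) n = trans
    (cong (λ r → seq (z a) n ℚ.+ (seq (z b) n ℚ.+ r)) (∑-↭ L↭ n))
    (solve 3 (λ a b r → a :+ (b :+ r) := b :+ (a :+ r)) refl
      (seq (z a) n) (seq (z b) n) (seq (∑ L′) n))
    where open ℚ-Solver.+-*-Solver
  ∑-↭ (↭.trans L↭ ↭L′) n = trans (∑-↭ L↭ n) (∑-↭ ↭L′ n)

  total-nonneg : ∀ {N : Pred A 0ℓ} M (N? : Decidable N) → (∀ a → 0ℝ ⊑ z a) →
                 0ℝ ⊑ total M z N?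
  total-nonneg M N? z≥0 = go (filter N? M)
    where
    go : ∀ L → 0ℝ ⊑ ∑ L
    go []      = ⊑-refl
    go (a ∷ L) = ⊑-trans (go L) (y⊑x+y (∑ L) (z≥0 a))

  total-mono : ∀ {N N′ : Pred A 0ℓ} M (N? : Decidable N) (N′? : Decidable N′) →
               (∀ a → 0ℝ ⊑ z a) → (∀ {a} → N a → N′ a) → total M z N? ⊑ total M z N′?
  total-mono [] N? N′? z≥0 N⊆N′ = ⊑-refl
  total-mono (a ∷ M) N? N′? z≥0 N⊆N′ with total-mono M N? N′? z≥0 N⊆N′ | N? a | N′? a
  ... | ih | yes n | yes _  = +-monoʳ-⊑ (z a) ih
  ... | ih | yes n | no ¬n′ with () ← ¬n′ (N⊆N′ n)
  ... | ih | no _  | yes _  = ⊑-trans ih (y⊑x+y (total M z N′?) (z≥0 a))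
  ... | ih | no _  | no _   = ih

module Enumeration {A : Set} {M : List A} (M! : Unique M) (∈M : ∀ a → a ∈ M) (z : A → ℝ) where

  -- Two duplicate-free lists with the same elements are permutations of each other. A sum can thus
  -- be evaluated on any explicit list of the members of `N`.
  total≐∑ : ∀ {N : Pred A 0ℓ} (N? : Decidable N) {L} → Unique L →
            (∀ {a} → N a → a ∈ L) → (∀ {a} → a ∈ L → N a) → total M z N? ≐ ∑ z L
  total≐∑ N? {L} L! N⊆L L⊆N = ∑-↭ z (∼bag⇒↭ (unique∧set⇒bag (Uniqueₚ.filter⁺ N? M!) L!
    (mk⇔ (λ a∈ → N⊆L (proj₂ (∈-filter⁻ N? {xs = M} a∈)))
         (λ a∈ → ∈-filter⁺ N? (∈M _) (L⊆N a∈)))))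

  total≐+total : ∀ {N N′ : Pred A 0ℓ} (N? : Decidable N) (N′? : Decidable N′) {e} → ¬ N′ e →
                 (∀ {a} → N a → a ≡ e ⊎ N′ a) → (∀ {a} → N′ a → N a) → N e →
                 total M z N? ≐ z e +ℝ total M z N′?
  total≐+total {N} N? N′? {e} e∉ N⊆ N′⊆ Ne = total≐∑ N?
    (All.tabulate (λ {a} a∈ → λ { refl → e∉ (proj₂ (∈-filter⁻ N′? {xs = M} a∈)) })
      ∷ Uniqueₚ.filter⁺ N′? M!)
    (λ n → [ here , (λ n′ → there (∈-filter⁺ N′? (∈M _) n′)) ]′ (N⊆ n))
    λ { (here refl) → Ne ; (there a∈) → N′⊆ (proj₂ (∈-filter⁻ N′? {xs = M} a∈)) }

  total≐single : ∀ {N : Pred A 0ℓ} (N? : Decidable N) {e} →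
                 (∀ {a} → N a → a ≡ e) → N e → total M z N? ≐ z e
  total≐single {N} N? {e} N⊆ Ne n = trans
    (total≐∑ N? {e ∷ []} ([] ∷ []) (λ n → here (N⊆ n)) (λ { (here refl) → Ne }) n)
    (ℚₚ.+-identityʳ (seq (z e) n))

module _ {A : Set} {n} {m : Fin n → ℕ} (f : ∀ i → Fin (m i) → A) where

  -- The common shape of `cells` and of the lists of vertical and of diagonal arcs; the lengths
  -- `m i` of the rows may differ.
  grid : List A
  grid = concat (tabulate λ i → tabulate (f i))

  ∈-grid⁺ : ∀ i j → f i j ∈ grid
  ∈-grid⁺ i j = ∈-concat⁺′ (∈-tabulate⁺ j) (∈-tabulate⁺ i)

  ∈-grid⁻ : ∀ {a} → a ∈ grid → ∃₂ λ i j → a ≡ f i j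
  ∈-grid⁻ a∈ with ∈-concat⁻′ (tabulate λ i → tabulate (f i)) a∈
  ... | _ , a∈row , row∈ with ∈-tabulate⁻ row∈
  ... | i , refl with ∈-tabulate⁻ a∈row
  ... | j , eq = i , j , eq

  grid-unique : (∀ {i j k l} → f i j ≡ f k l → i ≡ k) →
                (∀ i {j l} → f i j ≡ f i l → j ≡ l) → Unique grid
  grid-unique injᵢ injⱼ = Uniqueₚ.concat⁺
    (Allₚ.tabulate⁺ λ i → Uniqueₚ.tabulate⁺ (injⱼ i))
    (AllPairsₚ.tabulate⁺ λ {i} {k} i≢k → λ { (a∈i , a∈k) →
      i≢k (disjoint i k (∈-tabulate⁻ a∈i) (∈-tabulate⁻ a∈k)) })
    where
    disjoint : ∀ i k {a} → (∃ λ j → a ≡ f i j) → (∃ λ l → a ≡ f k l) → i ≡ k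
    disjoint i k (j , refl) (l , eq) = injᵢ eq

-- Irrelevant range conditions and extension by zero.

≤-recompute : ∀ {m n} → .(m ≤ n) → m ≤ n
≤-recompute {m} {n} m≤n = recompute (m ≤? n) m≤n

-- The function takes its proof irrelevantly, so the proof found by the decision and one supplied by
-- the caller give definitionally the same value.
extendByZero : {P : Set} → Dec P → (.P → ℝ) → ℝ
extendByZero (yes p) f = f p
extendByZero (no _)  _ = 0ℝ

extendByZero-yes : {P : Set} (P? : Dec P) (f : .P → ℝ) .(p : P) → extendByZero P? f ≡ f p
extendByZero-yes (yes _) f p = refl
extendByZero-yes (no ¬p) f p = ⊥-elim-irr (¬p p)

extendByZero-no : {P : Set} (P? : Dec P) (f : .P → ℝ) → ¬ P → extendByZero P? f ≡ 0ℝ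
extendByZero-no (yes p) f ¬p = contradiction p ¬p
extendByZero-no (no _)  f ¬p = refl

0⊑1 : 0ℝ ⊑ 1ℝ
0⊑1 = pointwise⇒⊑ λ _ → ℚₚ.nonNegative⁻¹ ℚ.1ℚ

<⇒toℕ : ∀ {n} i → .(i < n) → ∃ λ (k : Fin n) → i ≡ toℕ k
<⇒toℕ i i<n = fromℕ< i<n , sym (toℕ-fromℕ< i<n)

-- Duplicate-free enumerations of the cells and arcs.

module _ (p q : ℕ) .(q≤p : q ≤ p) where

  open Orbitope p q q≤p
  open DecMembership _≟ᴺ_ using (_∈?_)

  -- Indexed by the tail (i, j) of the diagonal arc that enters the cell, which avoids predecessors.
  cellAt : ∀ i j → .(i < p) → .(j < q⟨ suc i ⟩) → Cell
  cellAt i j i<p j<q = cell (suc i) (suc j) (s≤s z≤n) i<p (s≤s z≤n)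
    (m≤n⊓o⇒m≤o (suc i) q j<q) (m≤n⊓o⇒m≤n (suc i) q j<q)

  vertical-bound : ∀ i {j} → j ≤ q⟨ i ⟩ → j ≤ q⟨ suc i ⟩
  vertical-bound i h = ⊓-glb (m≤n⇒m≤1+n (m≤n⊓o⇒m≤n i q h)) (m≤n⊓o⇒m≤o i q h)

  diagonal-bound : ∀ i {j} → j < q⟨ suc i ⟩ → j ≤ q⟨ i ⟩
  diagonal-bound i h =
    ⊓-glb (s≤s⁻¹ (m≤n⊓o⇒m≤n (suc i) q h)) (<⇒≤ (m≤n⊓o⇒m≤o (suc i) q h))

  -- Column j + 1 reaches row i + 1 but not row i. As j + 1 ≤ q, the obstacle in row i can only be j
  -- + 1 > i, while j ≤ i.
  diagonal-top : ∀ i j .(j<q : j < q⟨ suc i ⟩) → ¬ j < q⟨ i ⟩ → i ≡ j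
  diagonal-top i j j<q j≮q = ≤-antisym
    (≮⇒≥ λ j<i → j≮q (⊓-glb j<i (m≤n⊓o⇒m≤o (suc i) q (≤-recompute j<q))))
    (s≤s⁻¹ (m≤n⊓o⇒m≤n (suc i) q (≤-recompute j<q)))

  unique-cells : Unique cells
  unique-cells = grid-unique (λ i j → cellAt (toℕ i) (toℕ j) (toℕ<n i) (toℕ<n j))
    (λ eq → toℕ-injective (suc-injective (cong row eq)))
    (λ _ eq → toℕ-injective (suc-injective (cong col eq)))

  ∈-cells : ∀ c → c ∈ cells
  ∈-cells (cell zero _ () _ _ _ _)
  ∈-cells (cell (suc _) zero _ _ () _ _)
  ∈-cells (cell (suc i) (suc j) _ i<p _ j≤q j≤i)
    with k , refl ← <⇒toℕ i i<p
    with l , refl ← <⇒toℕ {q⟨ suc (toℕ k) ⟩} j (⊓-glb j≤i j≤q)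
    = ∈-grid⁺ (λ i j → cellAt (toℕ i) (toℕ j) (toℕ<n i) (toℕ<n j)) k l

  private
    -- Applied with `cong`, these show that the enumerations are injective; the zeros are arbitrary.
    arcRow arcCol : Arc → ℕ
    arcRow (vert i j _ _) = i
    arcRow (diag i j _ _) = i
    arcRow source         = 0
    arcRow (sink j _)     = 0
    arcCol (vert i j _ _) = j
    arcCol (diag i j _ _) = j
    arcCol source         = 0
    arcCol (sink j _)     = j

    vertical : (i : Fin p) → Fin (suc q⟨ toℕ i ⟩) → Arc
    vertical i j = vert (toℕ i) (toℕ j) (toℕ<n i) (s≤s⁻¹ (toℕ<n j))

    diagonal : (i : Fin p) → Fin q⟨ suc (toℕ i) ⟩ → Arc
    diagonal i j = diag (toℕ i) (toℕ j) (toℕ<n i) (toℕ<n j)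

    toSink : Fin (suc q) → Arc
    toSink j = sink (toℕ j) (s≤s⁻¹ (toℕ<n j))

  unique-arcs : Unique arcs
  unique-arcs = Uniqueₚ.++⁺
    (grid-unique vertical (λ eq → toℕ-injective (cong arcRow eq))
                          (λ _ eq → toℕ-injective (cong arcCol eq)))
    (Uniqueₚ.++⁺
      (grid-unique diagonal (λ eq → toℕ-injective (cong arcRow eq))
                            (λ _ eq → toℕ-injective (cong arcCol eq)))
      (All.tabulate source≢
        ∷ Uniqueₚ.tabulate⁺ {f = toSink} (λ eq → toℕ-injective (cong arcCol eq)))
      (λ (a∈d , a∈s) → diagonal∉ (∈-grid⁻ diagonal a∈d) a∈s))
    (λ (a∈v , a∈r) → vertical∉ (∈-grid⁻ vertical a∈v) a∈r)
    where
    source≢ : ∀ {a} → a ∈ _ → source ≢ a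
    source≢ a∈ refl with ∈-tabulate⁻ {f = toSink} a∈
    ... | _ , ()
    diagonal∉ : ∀ {a} → (∃ λ i → ∃ λ j → a ≡ diagonal i j) → ¬ a ∈ source ∷ _
    diagonal∉ (_ , _ , refl) (there a∈) with ∈-tabulate⁻ {f = toSink} a∈
    ... | _ , ()
    vertical∉ : ∀ {a} → (∃ λ i → ∃ λ j → a ≡ vertical i j) → ¬ a ∈ grid diagonal ++ source ∷ _
    vertical∉ (_ , _ , refl) a∈ with ∈-++⁻ (grid diagonal) a∈
    ... | inj₁ a∈d with ∈-grid⁻ diagonal a∈d
    ...   | _ , _ , ()
    vertical∉ (_ , _ , refl) a∈ | inj₂ (there a∈s) with ∈-tabulate⁻ {f = toSink} a∈s
    ...   | _ , ()

  ∈-arcs : ∀ a → a ∈ arcs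
  ∈-arcs (vert i j i<p j≤q)
    with k , refl ← <⇒toℕ i i<p
    with l , refl ← <⇒toℕ {suc q⟨ toℕ k ⟩} j (s≤s j≤q)
    = ∈-++⁺ˡ (∈-grid⁺ vertical k l)
  ∈-arcs (diag i j i<p j<q)
    with k , refl ← <⇒toℕ i i<p
    with l , refl ← <⇒toℕ {q⟨ suc (toℕ k) ⟩} j j<q
    = ∈-++⁺ʳ (grid vertical) (∈-++⁺ˡ (∈-grid⁺ diagonal k l))
  ∈-arcs source = ∈-++⁺ʳ (grid vertical) (∈-++⁺ʳ (grid diagonal) (here refl))
  ∈-arcs (sink j j≤q) with l , refl ← <⇒toℕ {suc q} j (s≤s j≤q)
    = ∈-++⁺ʳ (grid vertical) (∈-++⁺ʳ (grid diagonal) (there (∈-tabulate⁺ {f = toSink} l)))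

  -- The greedy flow and its sums at nodes and into columns.

  module _ (x : Cell → ℝ) where

    opaque

      -- F i j is the flow that enters column j on diagonal arcs down to row i.  It is
      -- chosen as large as (a) and the vertical arcs allow, and it is 0 outside the graph.
      F : (i j : ℕ) → .(i ≤ p) → ℝ
      F i       zero    _   = 1ℝ
      F zero    (suc j) _   = 0ℝ
      F (suc i) (suc j) i<p = extendByZero (suc j ≤? q⟨ suc i ⟩) λ j<q →
        (F i (suc j) (<⇒≤ i<p) +ℝ x (cellAt i j i<p j<q)) ⊓ℝ F i j (<⇒≤ i<p)

      -- This and the next two equations are all that is used of `F` outside the opaque block.
      F-column₀ : ∀ i .(i≤p : i ≤ p) → F i 0 i≤p ≡ 1ℝ
      F-column₀ i i≤p = refl

      F-inside : ∀ i j .(i<p : i < p) .(j<q : j < q⟨ suc i ⟩) →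
        F (suc i) (suc j) i<p
          ≡ (F i (suc j) (<⇒≤ i<p) +ℝ x (cellAt i j i<p j<q)) ⊓ℝ F i j (<⇒≤ i<p)
      F-inside i j i<p j<q = extendByZero-yes (suc j ≤? q⟨ suc i ⟩)
        (λ h → (F i (suc j) (<⇒≤ i<p) +ℝ x (cellAt i j i<p h)) ⊓ℝ F i j (<⇒≤ i<p)) j<q

      F-outside : ∀ i j .(i≤p : i ≤ p) → ¬ j ≤ q⟨ i ⟩ → F i j i≤p ≡ 0ℝ
      F-outside i       zero    i≤p j≰q = contradiction z≤n j≰q
      F-outside zero    (suc j) i≤p j≰q = refl
      F-outside (suc i) (suc j) i<p j≰q = extendByZero-no (suc j ≤? q⟨ suc i ⟩)
        (λ h → (F i (suc j) (<⇒≤ i<p) +ℝ x (cellAt i j i<p h)) ⊓ℝ F i j (<⇒≤ i<p)) j≰q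

    flow : Arc → ℝ
    flow (vert i j i<p _) = F i j (<⇒≤ i<p) -ℝ F (suc i) (suc j) i<p
    flow (diag i j i<p _) = F (suc i) (suc j) i<p -ℝ F i (suc j) (<⇒≤ i<p)
    flow source           = 1ℝ
    -- What has entered column j by row p without going on to column j + 1.
    flow (sink j _)       = F p j ≤-refl -ℝ F p (suc j) ≤-refl

    private
      module x∑ = Enumeration unique-cells ∈-cells x
      module y∑ = Enumeration unique-arcs ∈-arcs flow
      open ℚ-Solver.+-*-Solver

    -- The vertical arc brings F (i-1) j - F i (j+1) and the diagonal arc F i j - F (i-1) j, so F
    -- (i-1) j cancels. `outflow` reaches the same value, and this gives conservation.
    inflow : ∀ i j .(i≤p : i ≤ p) .(j≤q : j ≤ q⟨ i ⟩) →
      total arcs flow (λ a → head a ≟ᴺ pt i j i≤p j≤q) ≐ F i j i≤p -ℝ F i (suc j) i≤p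
    inflow zero zero i≤p j≤q n = trans
      (y∑.total≐single (λ a → head a ≟ᴺ pt 0 0 i≤p j≤q) {source}
        (λ { {source} _ → refl ; {vert _ _ _ _} () ; {diag _ _ _ _} () ; {sink _ _} () }) refl n)
      (sym (cong₂ (λ y z → seq (y -ℝ z) n) (F-column₀ 0 i≤p) (F-outside 0 1 i≤p λ ())))
    inflow zero (suc j) _ ()
    -- Only a vertical arc enters column 0 here, and F is 1 in both rows.
    inflow (suc i) zero i<p j≤q n = trans
      (y∑.total≐single (λ a → head a ≟ᴺ pt (suc i) 0 i<p j≤q) {vert i 0 i<p z≤n}
        (λ { {vert _ _ _ _} refl → refl ; {source} () ; {diag _ _ _ _} () ; {sink _ _} () }) refl n)
      (cong (λ z → seq (z -ℝ F (suc i) 1 i<p) n)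
        (trans (F-column₀ i (<⇒≤ i<p)) (sym (F-column₀ (suc i) i<p))))
    inflow (suc i) (suc j) i<p j<q n with suc j ≤? q⟨ i ⟩
    ... | yes j<qᵢ = trans
      (y∑.total≐∑ (λ a → head a ≟ᴺ pt (suc i) (suc j) i<p j<q)
        {vert i (suc j) i<p j<qᵢ ∷ diag i j i<p j<q ∷ []} (((λ ()) ∷ []) ∷ [] ∷ [])
        (λ { {vert _ _ _ _} refl → here refl ; {diag _ _ _ _} refl → there (here refl)
           ; {source} () ; {sink _ _} () })
        (λ { (here refl) → refl ; (there (here refl)) → refl }) n)
      (solve 3 (λ a b c → (a :- b) :+ ((c :- a) :+ con ℚ.0ℚ) := c :- b) refl
        (seq (F i (suc j) (<⇒≤ i<p)) n) (seq (F (suc i) (suc (suc j)) i<p) n)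
        (seq (F (suc i) (suc j) i<p) n))
    -- The cell is the top of its column and no vertical arc enters it; the formula for that arc
    -- would give 0 - 0.
    ... | no j≮qᵢ = trans
      (y∑.total≐single (λ a → head a ≟ᴺ pt (suc i) (suc j) i<p j<q) {diag i j i<p j<q}
        (λ { {vert _ _ _ j<qᵢ} refl → contradiction (≤-recompute j<qᵢ) j≮qᵢ
           ; {diag _ _ _ _} refl → refl ; {source} () ; {sink _ _} () }) refl n)
      (cong (λ z → seq (F (suc i) (suc j) i<p -ℝ z) n) zeros)
      where
      zeros : F i (suc j) (<⇒≤ i<p) ≡ F (suc i) (suc (suc j)) i<p
      zeros = trans (F-outside i (suc j) (<⇒≤ i<p) j≮qᵢ)
        (sym (F-outside (suc i) (suc (suc j)) i<p λ h → j≮qᵢ (diagonal-bound i h)))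

    outflow : ∀ i j .(i≤p : i ≤ p) .(j≤q : j ≤ q⟨ i ⟩) →
      total arcs flow (λ a → tail a ≟ᴺ pt i j i≤p j≤q) ≐ F i j i≤p -ℝ F i (suc j) i≤p
    outflow i j i≤p j≤q n with i <? p
    ... | no i≮p with refl ← ≤-antisym (≤-recompute i≤p) (≮⇒≥ i≮p) =
      y∑.total≐single (λ a → tail a ≟ᴺ pt i j i≤p j≤q) {sink j (m≤n⊓o⇒m≤o p q j≤q)}
        (λ { {vert _ _ p<p _} refl → contradiction (≤-recompute p<p) (<-irrefl refl)
           ; {diag _ _ p<p _} refl → contradiction (≤-recompute p<p) (<-irrefl refl)
           ; {sink _ _} refl → refl ; {source} () }) refl n
    ... | yes i<p with suc j ≤? q⟨ suc i ⟩
    ...   | yes j<q = trans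
      (y∑.total≐∑ (λ a → tail a ≟ᴺ pt i j i≤p j≤q)
        {vert i j i<p j≤q ∷ diag i j i<p j<q ∷ []} (((λ ()) ∷ []) ∷ [] ∷ [])
        (λ { {vert _ _ _ _} refl → here refl ; {diag _ _ _ _} refl → there (here refl)
           ; {source} () ; {sink _ _} refl → contradiction i<p (<-irrefl refl) })
        (λ { (here refl) → refl ; (there (here refl)) → refl }) n)
      (solve 3 (λ a b c → (a :- b) :+ ((b :- c) :+ con ℚ.0ℚ) := a :- c) refl
        (seq (F i j i≤p) n) (seq (F (suc i) (suc j) i<p) n) (seq (F i (suc j) i≤p) n))
    -- Here j = q, so no diagonal arc leaves; its formula would again give 0 - 0.
    ...   | no j≮q = trans
      (y∑.total≐single (λ a → tail a ≟ᴺ pt i j i≤p j≤q) {vert i j i<p j≤q}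
        (λ { {vert _ _ _ _} refl → refl
           ; {diag _ _ _ j<q} refl → contradiction (≤-recompute j<q) j≮q
           ; {source} () ; {sink _ _} refl → contradiction i<p (<-irrefl refl) }) refl n)
      (cong (λ z → seq (F i j i≤p -ℝ z) n) zeros)
      where
      zeros : F (suc i) (suc j) i<p ≡ F i (suc j) i≤p
      zeros = trans (F-outside (suc i) (suc j) i<p j≮q)
        (sym (F-outside i (suc j) i≤p λ h → j≮q (vertical-bound i h)))

    -- Diagonal arcs change the column, so each one with its head in the column starts outside it.
    -- Their flows are the increments of F down the column, and the sum telescopes.
    columnInflow : ∀ i j .(i<p : i < p) .(j<q : j < q⟨ suc i ⟩) →
      total arcs flow (in↘? (col? (cellAt i j i<p j<q))) ≐ F (suc i) (suc j) i<p
    columnInflow i j i<p j<q n with suc j ≤? q⟨ i ⟩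
    columnInflow (suc i) j i<p j<q n | yes j<qᵢ = trans
      (y∑.total≐+total (in↘? (col? (cellAt (suc i) j i<p j<q)))
        (in↘? (col? (cellAt i j (<⇒≤ i<p) j<qᵢ)))
        {diag (suc i) j i<p j<q} (λ (_ , (_ , _ , i<i) , _) → <-irrefl refl i<i)
        split
        (λ { {diag k l _ _} (_ , (refl , j≤k , k≤i) , _) →
             tt , (refl , j≤k , m≤n⇒m≤1+n k≤i) , λ (l≡1+l , _) → 1+n≢n (sym l≡1+l) })
        (tt , (refl , m≤n⊓o⇒m≤n (suc (suc i)) q (≤-recompute j<q) , ≤-refl) ,
          λ (l≡1+l , _) → 1+n≢n (sym l≡1+l)) n)
      (trans (cong (seq (flow (diag (suc i) j i<p j<q)) n ℚ.+_)
               (columnInflow i j (<⇒≤ i<p) j<qᵢ n))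
        (solve 2 (λ a b → (a :- b) :+ b := a) refl
          (seq (F (suc (suc i)) (suc j) i<p) n) (seq (F (suc i) (suc j) (<⇒≤ i<p)) n)))
      where
      split : ∀ {a} → In↘ (Col (cellAt (suc i) j i<p j<q)) a →
        a ≡ diag (suc i) j i<p j<q ⊎ In↘ (Col (cellAt i j (<⇒≤ i<p) j<qᵢ)) a
      split {diag k l _ _} (_ , (refl , j≤k , k≤i) , _) with m≤n⇒m<n∨m≡n k≤i
      ... | inj₁ k<i  = inj₂ (tt , (refl , j≤k , s≤s⁻¹ k<i) , λ (l≡1+l , _) → 1+n≢n (sym l≡1+l))
      ... | inj₂ refl = inj₁ refl
    -- At the top of the column a single arc remains, and the telescoping sum starts from F i (j+1)
    -- = 0, a value outside the graph.
    columnInflow i j i<p j<q n | no j≮qᵢ = trans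
      (y∑.total≐single (in↘? (col? (cellAt i j i<p j<q))) {diag i j i<p j<q} top
        (tt , (refl , m≤n⊓o⇒m≤n (suc i) q (≤-recompute j<q) , ≤-refl) ,
          λ (l≡1+l , _) → 1+n≢n (sym l≡1+l)) n)
      (trans (cong (λ z → seq (F (suc i) (suc j) i<p -ℝ z) n) (F-outside i (suc j) (<⇒≤ i<p) j≮qᵢ))
        (ℚₚ.+-identityʳ _))
      where
      top : ∀ {a} → In↘ (Col (cellAt i j i<p j<q)) a → a ≡ diag i j i<p j<q
      top {diag k l _ _} (_ , (refl , j≤k , k≤i) , _) with m≤n⇒m<n∨m≡n k≤i
      ... | inj₁ k<i  = contradiction
        (⊓-glb (≤-trans j≤k (s≤s⁻¹ k<i)) (m≤n⊓o⇒m≤o (suc i) q (≤-recompute j<q))) j≮qᵢ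
      ... | inj₂ refl = refl

    bar-step : ∀ i j .(i<p : i < p) .(j<q : j < q⟨ suc i ⟩) .(1+j<q : suc j < q⟨ suc i ⟩) →
      total cells x (bar? (cellAt i j i<p j<q))
        ≐ x (cellAt i j i<p j<q) +ℝ total cells x (bar? (cellAt i (suc j) i<p 1+j<q))
    bar-step i j i<p j<q 1+j<q = x∑.total≐+total
      (bar? (cellAt i j i<p j<q)) (bar? (cellAt i (suc j) i<p 1+j<q))
      (λ (_ , j<j) → <-irrefl refl j<j) split (λ (r , c) → r , <⇒≤ c) (refl , ≤-refl)
      where
      split : ∀ {e} → Bar (cellAt i j i<p j<q) e →
              e ≡ cellAt i j i<p j<q ⊎ Bar (cellAt i (suc j) i<p 1+j<q) e
      split (refl , j≤c) with m≤n⇒m<n∨m≡n j≤c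
      ... | inj₁ j<c  = inj₂ (refl , j<c)
      ... | inj₂ refl = inj₁ refl

    bar-last : ∀ i j .(i<p : i < p) .(j<q : j < q⟨ suc i ⟩) → ¬ suc j < q⟨ suc i ⟩ →
      total cells x (bar? (cellAt i j i<p j<q)) ≐ x (cellAt i j i<p j<q)
    bar-last i j i<p j<q 1+j≮q = x∑.total≐single (bar? (cellAt i j i<p j<q)) only (refl , ≤-refl)
      where
      only : ∀ {e} → Bar (cellAt i j i<p j<q) e → e ≡ cellAt i j i<p j<q
      only {cell _ _ _ _ _ c≤q c≤r} (refl , j≤c) with m≤n⇒m<n∨m≡n j≤c
      ... | inj₁ j<c  = contradiction
        (≤-trans j<c (⊓-glb (≤-recompute c≤r) (≤-recompute c≤q))) 1+j≮q
      ... | inj₂ refl = refl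

    -- Monotonicity of `F` and nonnegativity of the flow.

    module _ (x≥0 : ∀ e → 0ℝ ⊑ x e) where

      0⊑F : ∀ i j .(i≤p : i ≤ p) → 0ℝ ⊑ F i j i≤p
      0⊑F i zero i≤p = subst (0ℝ ⊑_) (sym (F-column₀ i i≤p)) 0⊑1
      0⊑F zero (suc j) i≤p = subst (0ℝ ⊑_) (sym (F-outside zero (suc j) i≤p λ ())) ⊑-refl
      0⊑F (suc i) (suc j) i<p with suc j ≤? q⟨ suc i ⟩
      ... | yes j<q = subst (0ℝ ⊑_) (sym (F-inside i j i<p j<q)) (⊓ℝ-glb
        (⊑-trans (0⊑F i (suc j) (<⇒≤ i<p)) (y⊑y+x _ (x≥0 (cellAt i j i<p j<q))))
        (0⊑F i j (<⇒≤ i<p)))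
      ... | no j≮q  = subst (0ℝ ⊑_) (sym (F-outside (suc i) (suc j) i<p j≮q)) ⊑-refl

      -- Gives nonnegativity on the vertical arcs; `F-vertical` does so for the diagonal arcs and
      -- `F-horizontal` for the arcs into `t`.
      F-diagonal : ∀ i j .(i<p : i < p) → F (suc i) (suc j) i<p ⊑ F i j (<⇒≤ i<p)
      F-diagonal i j i<p with suc j ≤? q⟨ suc i ⟩
      ... | yes j<q = subst (_⊑ F i j (<⇒≤ i<p)) (sym (F-inside i j i<p j<q)) (x⊓y⊑y _ _)
      ... | no j≮q  = subst (_⊑ F i j (<⇒≤ i<p)) (sym (F-outside (suc i) (suc j) i<p j≮q))
        (0⊑F i j (<⇒≤ i<p))

      -- A mutual induction on rows: the step down from row i compares the second argument of the
      -- minimum by a horizontal step in row i, and a horizontal step in row i + 1 is a diagonal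
      -- step up followed by a vertical one down.
      F-vertical   : ∀ i j .(i<p : i < p) → F i j (<⇒≤ i<p) ⊑ F (suc i) j i<p
      F-horizontal : ∀ i j .(i≤p : i ≤ p) → F i (suc j) i≤p ⊑ F i j i≤p

      F-vertical i zero i<p = subst (F i 0 (<⇒≤ i<p) ⊑_)
        (trans (F-column₀ i (<⇒≤ i<p)) (sym (F-column₀ (suc i) i<p))) ⊑-refl
      F-vertical i (suc j) i<p with suc j ≤? q⟨ suc i ⟩
      ... | yes j<q = subst (F i (suc j) (<⇒≤ i<p) ⊑_) (sym (F-inside i j i<p j<q))
        (⊓ℝ-glb (y⊑y+x _ (x≥0 (cellAt i j i<p j<q))) (F-horizontal i j (<⇒≤ i<p)))
      ... | no j≮q  = subst (_⊑ F (suc i) (suc j) i<p)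
        (sym (F-outside i (suc j) (<⇒≤ i<p) λ h → j≮q (vertical-bound i h)))
        (0⊑F (suc i) (suc j) i<p)

      F-horizontal zero    j i≤p =
        subst (_⊑ F 0 j i≤p) (sym (F-outside 0 (suc j) i≤p λ ())) (0⊑F 0 j i≤p)
      F-horizontal (suc i) j i<p = ⊑-trans (F-diagonal i j i<p) (F-vertical i j i<p)

      0⊑flow : ∀ a → 0ℝ ⊑ flow a
      0⊑flow (vert i j i<p _) = x⊑y⇒0⊑y-x (F-diagonal i j i<p)
      0⊑flow (diag i j i<p _) = x⊑y⇒0⊑y-x (F-vertical i (suc j) i<p)
      0⊑flow source           = 0⊑1
      0⊑flow (sink j _)       = x⊑y⇒0⊑y-x (F-horizontal p j ≤-refl)

      -- Weights of paths and the lower bound on `F`.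

      weight : List Node → ℝ
      weight L = total cells x (λ e → node e ∈? L)

      -- The inequality allows `c` to lie in `L` already, so it need not be shown that a path visits
      -- no node twice.
      weight-∷ : ∀ c L → weight (node c ∷ L) ⊑ x c +ℝ weight L
      weight-∷ c L with node c ∈? L
      ... | yes c∈L = ⊑-trans
        (total-mono x cells (λ e → node e ∈? (node c ∷ L)) (λ e → node e ∈? L) x≥0
          λ { (here eq) → subst (_∈ L) (sym eq) c∈L ; (there e∈L) → e∈L })
        (y⊑x+y (weight L) (x≥0 c))
      ... | no c∉L = ≐⇒⊑ (x∑.total≐+total (λ e → node e ∈? (node c ∷ L)) (λ e → node e ∈? L)
        c∉L (λ { (here eq) → inj₁ (node-injective eq) ; (there e∈L) → inj₂ e∈L }) there (here refl))
        where
        node-injective : ∀ {c d} → node c ≡ node d → c ≡ d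
        node-injective refl = refl

      0⊑weight : ∀ L → 0ℝ ⊑ weight L
      0⊑weight L = total-nonneg x cells (λ e → node e ∈? L) x≥0

      -- Range proofs are irrelevant, so for i = j the start of Γ is definitionally a
      -- `diagonalNode`, and Γ itself is one of the paths in the hypothesis.
      bounds-diagonal : ∀ i j .(i<p : i < p) .(j<q : j < q⟨ suc i ⟩) → i ≡ j →
        ∀ {v} (Γ : Path (pt (suc i) (suc j) i<p j<q) v) {A} →
        (∀ l → 1 ≤ l → (l≤q : l ≤ q) (Γ′ : Path (diagonalNode l l≤q) v) → A ⊑ weight (S Γ′)) →
        A ⊑ weight (S Γ)
      bounds-diagonal i i i<p j<q refl Γ A⊑S =
        A⊑S (suc i) (s≤s z≤n) (m≤n⊓o⇒m≤o (suc i) q (≤-recompute j<q)) Γ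

      -- Unfolding the recursion of F from (i, j) upwards traces a path backwards; Γ is
      -- the part traced so far.  Each branch ends in column 0, where F is 1, or above
      -- some (ℓ, ℓ), where F is 0 and x(S(Γ)) has been collected.
      bounds⇒⊑F : ∀ i j .(i≤p : i ≤ p) .(j≤q : j ≤ q⟨ i ⟩) {v} (Γ : Path (pt i j i≤p j≤q) v) {A} →
        A ⊑ 1ℝ →
        (∀ l → 1 ≤ l → (l≤q : l ≤ q) (Γ′ : Path (diagonalNode l l≤q) v) → A ⊑ weight (S Γ′)) →
        A ⊑ F i j i≤p +ℝ weight (enteredNonDiagonally Γ)
      bounds⇒⊑F i zero i≤p j≤q Γ {A} A⊑1 A⊑S =
        ⊑-trans (subst (A ⊑_) (sym (F-column₀ i i≤p)) A⊑1)
          (y⊑y+x _ (0⊑weight (enteredNonDiagonally Γ)))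
      bounds⇒⊑F zero (suc j) i≤p () Γ A⊑1 A⊑S
      bounds⇒⊑F (suc i) (suc j) i<p j<q {v} Γ {A} A⊑1 A⊑S =
        subst (λ z → A ⊑ z +ℝ w) (sym (F-inside i j i<p j<q))
          (⊓ℝ-+ℝ-glb w (fromAbove (suc j ≤? q⟨ i ⟩))
            -- Prolonging Γ backwards by a diagonal arc leaves `enteredNonDiagonally` unchanged, so
            -- `w` stays.
            (bounds⇒⊑F i j (<⇒≤ i<p) (diagonal-bound i j<q) (diag i j i<p j<q ◅ Γ) A⊑1 A⊑S))
        where
        c = cellAt i j i<p j<q
        w = weight (enteredNonDiagonally Γ)
        above = F i (suc j) (<⇒≤ i<p)

        -- The list here is `S Γ`, and it is also `enteredNonDiagonally` of Γ prolonged by a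
        -- vertical arc into `c`. So x c is charged both when the trace stops at `c` and when it
        -- goes on upwards.
        regroup : A ⊑ above +ℝ weight (node c ∷ enteredNonDiagonally Γ) → A ⊑ (above +ℝ x c) +ℝ w
        regroup A⊑ = ⊑-trans A⊑ (⊑-trans
          (+-monoʳ-⊑ above (weight-∷ c (enteredNonDiagonally Γ)))
          (≐⇒⊑ λ n → sym (ℚₚ.+-assoc (seq above n) (seq (x c) n) (seq w n))))

        fromAbove : Dec (suc j ≤ q⟨ i ⟩) → A ⊑ (above +ℝ x c) +ℝ w
        fromAbove (yes j<qᵢ) = regroup
          (bounds⇒⊑F i (suc j) (<⇒≤ i<p) j<qᵢ (vert i (suc j) i<p j<qᵢ ◅ Γ) A⊑1 A⊑S)
        fromAbove (no j≮qᵢ) = regroup (⊑-trans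
          (bounds-diagonal i j i<p j<q (diagonal-top i j j<q j≮qᵢ) Γ A⊑S)
          (y⊑x+y (weight (S Γ)) (0⊑F i (suc j) (<⇒≤ i<p))))

  -- From the inequalities of Q to membership in P.

  module _ (x : Cell → ℝ) (x∈Q : x ∈Q) where

    open _∈Q x∈Q

    private
      module x∑ = Enumeration unique-cells ∈-cells x

      x≥0 : ∀ e → 0ℝ ⊑ x e
      x≥0 e = wrap (nonneg e)

    bar⊑1 : ∀ c → total cells x (bar? c) ⊑ 1ℝ
    bar⊑1 c@(cell i j 1≤i i≤p _ _ _) = ⊑-trans
      (total-mono x cells (bar? c) (row? i) x≥0 proj₁)
      (wrap (rowSum i (≤-recompute 1≤i) (≤-recompute i≤p)))

    -- The bar starts at (i+1, j+1). For j = 0 it is a whole row and the row-sum inequality applies;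
    -- otherwise the cell has row and column at least 2, as the shifted-column inequalities require.
    bar⊑F : ∀ i j .(i<p : i < p) .(j<q : j < q⟨ suc i ⟩) →
      total cells x (bar? (cellAt i j i<p j<q)) ⊑ F x i j (<⇒≤ i<p)
    bar⊑F i zero i<p j<q = subst (total cells x (bar? (cellAt i 0 i<p j<q)) ⊑_)
      (sym (F-column₀ x i (<⇒≤ i<p))) (bar⊑1 (cellAt i 0 i<p j<q))
    bar⊑F zero (suc j) i<p j<q =
      contradiction (m≤n⊓o⇒m≤n 1 q (≤-recompute j<q)) λ { (s≤s ()) }
    bar⊑F (suc i) (suc j) i<p j<q = ⊑-trans
      -- The trace starts from the path of length zero at `northwest c`, so every path it completes
      -- belongs to a shifted-column inequality of `c`. Nothing has been collected yet, and the
      -- remaining weight is 0.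
      (bounds⇒⊑F x x≥0 (suc i) (suc j) (<⇒≤ i<p) _ stop (bar⊑1 c)
        λ l 1≤l l≤q Γ → wrap (shiftedColumn c (λ ()) (λ ()) l 1≤l l≤q Γ))
      (≐⇒⊑ λ n → trans (cong (seq (F x (suc i) (suc j) (<⇒≤ i<p)) n ℚ.+_)
          (x∑.total≐∑ (λ e → node e ∈? []) [] (λ ()) (λ ()) n))
        (ℚₚ.+-identityʳ _))
      where c = cellAt (suc i) (suc j) i<p j<q

    -- This is (b), by `columnInflow`. Against the first argument of the minimum, split off the cell
    -- `c` and apply `bar⊑F` to the rest of the bar, which starts one column further right; against
    -- the second, apply `bar⊑F` directly.
    bar⊑F₊ : ∀ i j .(i<p : i < p) .(j<q : j < q⟨ suc i ⟩) →
      total cells x (bar? (cellAt i j i<p j<q)) ⊑ F x (suc i) (suc j) i<p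
    bar⊑F₊ i j i<p j<q = subst (total cells x (bar? c) ⊑_) (sym (F-inside x i j i<p j<q))
      (⊓ℝ-glb fromAbove (bar⊑F i j i<p j<q))
      where
      c = cellAt i j i<p j<q
      fromAbove : total cells x (bar? c) ⊑ F x i (suc j) (<⇒≤ i<p) +ℝ x c
      fromAbove with suc (suc j) ≤? q⟨ suc i ⟩
      ... | yes 1+j<q = ⊑-trans (≐⇒⊑ λ n → trans (bar-step x i j i<p j<q 1+j<q n)
                                      (ℚₚ.+-comm (seq (x c) n) _))
                          (+-monoˡ-⊑ (x c) (bar⊑F i (suc j) i<p 1+j<q))
      ... | no 1+j≮q  = ⊑-trans (≐⇒⊑ (bar-last x i j i<p j<q 1+j≮q))
                          (y⊑x+y (x c) (0⊑F x x≥0 i (suc j) (<⇒≤ i<p)))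

    flow∈F : flow x ∈F
    flow∈F ._∈F.nonneg a = unwrap (0⊑flow x x≥0 a)
    flow∈F ._∈F.conservation v@(pt i j i≤p j≤q) _ _ = ≐⇒≈ℝ
      (total arcs (flow x) (λ a → head a ≟ᴺ v)) (total arcs (flow x) (λ a → tail a ≟ᴺ v))
      λ n → trans (inflow x i j i≤p j≤q n) (sym (outflow x i j i≤p j≤q n))
    flow∈F ._∈F.conservation s s≢s _ = contradiction refl s≢s
    flow∈F ._∈F.conservation t _ t≢t = contradiction refl t≢t
    flow∈F ._∈F.value = ≐⇒≈ℝ (total arcs (flow x) (λ a → tail a ≟ᴺ s)) 1ℝ
      (Enumeration.total≐single unique-arcs ∈-arcs (flow x) (λ a → tail a ≟ᴺ s) {source}
        (λ { {source} _ → refl ; {vert _ _ _ _} () ; {diag _ _ _ _} () ; {sink _ _} () }) refl)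

    flow∈P : ⟨ x , flow x ⟩∈P
    flow∈P .⟨_,_⟩∈P.flow = flow∈F
    flow∈P .⟨_,_⟩∈P.diag≤x (cell zero _ () _ _ _ _)
    flow∈P .⟨_,_⟩∈P.diag≤x (cell (suc _) zero _ _ () _ _)
    flow∈P .⟨_,_⟩∈P.diag≤x (cell (suc i) (suc j) _ i<p _ j≤q j≤i) =
      -- (a) is the bound of the minimum by its first argument.
      unwrap (x⊑y+z⇒x-y⊑z {F x (suc i) (suc j) i<p} {above} {x c}
        (subst (_⊑ above +ℝ x c) (sym (F-inside x i j i<p (⊓-glb j≤i j≤q)))
          (x⊓y⊑x (above +ℝ x c) (F x i j (<⇒≤ i<p)))))
      where
      c = cellAt i j i<p (⊓-glb j≤i j≤q)
      above = F x i (suc j) (<⇒≤ i<p)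
    flow∈P .⟨_,_⟩∈P.bar≤in (cell zero _ () _ _ _ _)
    flow∈P .⟨_,_⟩∈P.bar≤in (cell (suc _) zero _ _ () _ _)
    flow∈P .⟨_,_⟩∈P.bar≤in (cell (suc i) (suc j) _ i<p _ j≤q j≤i) = unwrap (⊑-trans
      (bar⊑F₊ i j i<p (⊓-glb j≤i j≤q))
      (≐⇒⊑ {y = total arcs (flow x) (in↘? (col? (cellAt i j i<p (⊓-glb j≤i j≤q))))}
        λ n → sym (columnInflow x i j i<p (⊓-glb j≤i j≤q) n)))

theorem12 : (p q : ℕ) → 1 ≤ q → (q≤p : q ≤ p) →
    let open Orbitope p q q≤p in
    (x : Cell → ℝ) → x ∈Q → ∃ λ (y : Arc → ℝ) → y ∈F × ⟨ x , y ⟩∈P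
theorem12 p q _ q≤p x x∈Q = flow p q q≤p x , flow∈F p q q≤p x x∈Q , flow∈P p q q≤p x x∈Q
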